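{- Let $n,k$ be positive integers and let $\mathcal{D}_{n,k}$ be a set such that for every length-$n$ permutation $\sigma$, every length-$k$ permutation $\pi$ and every solution $f$ to $(\sigma,\pi)$ there exists exactly one $D\in\mathcal{D}_{n,k}$ such that $D$ is a segment decomposition of $(\sigma,\pi)$ and $f$ respects $D$. Then $$|\mathcal{D}_{n,k}|\ \geq\ \binom{\lfloor \frac{n-1}{2}\rfloor}{\lfloor \frac{k}{2}\rfloor}.$$
   Context: For a positive integer $m$, $[m]=\{1,\ldots,m\}$, and $[a,b]=\{a,a+1,\ldots,b\}$ for integers $a\le b$. A permutation of length $m$ is a bijection $[m]\to[m]$. For a length-$n$ permutation $\sigma$ and a length-$k$ permutation $\pi$, a solution to $(\sigma,\pi)$ is an injection $f:[k]\to[n]$ such that for all $i,j\in[k]$: (1) $\pi(i)<\pi(j)\Leftrightarrow\sigma(f(i))<\sigma(f(j))$, and (2) $i<j\Leftrightarrow f(i)<f(j)$. A segment decomposition of $(\sigma,\pi)$ is a sequence of $k$ segments $[\ell_1,r_1],\ldots,[\ell_k,r_k]$ such that (1) $\ell_i\le r_i$ for $i\in[k]$, (2) $[\ell_i,r_i]\subseteq[n]$ for $i\in[k]$, (3) $r_i\le\ell_{i+1}$ for $i\in[k-1]$. (This notion depends only on $n$ and $k$.) A solution $f$ respects the segment decomposition if $f(i)\in[\ell_i,r_i]$ for all $i\in[k]$. -}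

module Defs where

open import Data.Fin.Base as Fin using (Fin; toℕ)
open import Data.Fin.Permutation using (Permutation′; _⟨$⟩ʳ_)
open import Data.Integer.Base using (ℤ; +_; _≤_)
open import Data.Nat.Base using (ℕ; suc)
open import Data.Product.Base using (∃; _×_; proj₁; proj₂)
open import Data.Vec.Base using (Vec; lookup)
open import Function.Bundles using (_⇔_)
open import Function.Definitions using (Injective)
open import Level using (Level; 0ℓ; _⊔_)
open import Relation.Binary.PropositionalEquality using (_≡_)
open import Relation.Unary using (Pred; _∈_; _⊆_)

private
  variable
    a p : Level
    n k : ℕ

record IsSolution (σ : Permutation′ n) (π : Permutation′ k)
                  (f : Fin k → Fin n) : Set where
  field
    injective : Injective _≡_ _≡_ f
    values    : ∀ i j → (π ⟨$⟩ʳ i Fin.< π ⟨$⟩ʳ j) ⇔ (σ ⟨$⟩ʳ f i Fin.< σ ⟨$⟩ʳ f j)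
    positions : ∀ i j → (i Fin.< j) ⇔ (f i Fin.< f j)

⟦_,_⟧ : ℤ → ℤ → Pred ℤ 0ℓ
⟦ l , r ⟧ x = l ≤ x × x ≤ r

-- Fin n stands for {1,…,n}; as an integer, its i-th element is i + 1 because
-- toℕ counts from 0.
⌜_⌝ : Fin n → ℤ
⌜ i ⌝ = + suc (toℕ i)

-- A segment [l,r] is given by its pair of endpoints.  The requirement l ≤ r is
-- imposed in IsSegmentDecomposition, not here.
Segment : Set
Segment = ℤ × ℤ

left right : Vec Segment k → Fin k → ℤ
left  D i = proj₁ (lookup D i)
right D i = proj₂ (lookup D i)

-- Being a segment decomposition of (σ,π) depends only on the lengths n of σ
-- and k of π.
record IsSegmentDecomposition (n : ℕ) (D : Vec Segment k) : Set where
  field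
    nonempty : ∀ i → left D i ≤ right D i
    inRange  : ∀ i → ⟦ left D i , right D i ⟧ ⊆ ⟦ + 1 , + n ⟧
    ordered  : ∀ i j → toℕ j ≡ suc (toℕ i) → right D i ≤ left D j

Respects : (Fin k → Fin n) → Vec Segment k → Set
Respects f D = ∀ i → ⌜ f i ⌝ ∈ ⟦ left D i , right D i ⟧

-- |S| ≥ N for an arbitrary, possibly infinite, set S: there are N pairwise
-- distinct elements of S.  Distinctness is that of the underlying elements of
-- A, so different proofs of membership are not counted twice.
HasAtLeast : {A : Set a} → ℕ → Pred A p → Set (a ⊔ p)
HasAtLeast {A = A} N S =
  ∃ λ (e : Fin N → A) → Injective _≡_ _≡_ e × (∀ i → e i ∈ S)

{-# OPTIONS --safe #-}
-- Take σ and π to be identities, so that every increasing f is a solution.  In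
-- such an f, force the positions 2j and 2j+1 (counted from 0) to take values
-- 2a and 2a+1, so that the points f(2j), f(2j+1) fill one of the ⌊(n-1)/2⌋
-- disjoint pairs of neighbours; when k is odd, the last position comes after
-- all pairs.  If f and g respect the same decomposition, then
-- f(i) ≤ rᵢ ≤ ℓᵢ₊₁ ≤ g(i+1) and vice versa, which at the first pair chosen by
-- one of f, g and not by the other is impossible.  So distinct choices of pairs
-- need distinct decompositions.
module Submission where

open import Data.Fin.Base as Fin using (Fin; toℕ; fromℕ<; splitAt; join)
open import Data.Fin.Permutation using (Permutation′) renaming (id to idₚ)
open import Data.Fin.Properties using (toℕ<n; toℕ-fromℕ<; toℕ-injective; join-splitAt)
open import Data.Integer.Properties as ℤ using (drop‿+≤+)
open import Data.Nat.Base
  using (ℕ; zero; suc; _+_; _*_; _≤_; _<_; s≤s; z<s; s<s; s≤s⁻¹; s<s⁻¹; NonZero; _∸_)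
open import Data.Nat.Properties
open import Data.Nat.DivMod using (_/_; _%_; m/n*n≤m; m%n<n; m≡m%n+[m/n]*n)
open import Data.Nat.Combinatorics using (_C_; nCk+nC[k+1]≡[n+1]C[k+1])
open import Data.Product using (∃!; _×_; _,_; proj₁; proj₂)
open import Data.Sum.Base using (_⊎_; inj₁; inj₂)
open import Data.Vec.Base using (Vec)
open import Function.Base using (_∘_)
open import Function.Bundles using (_⇔_; mk⇔)
open import Function.Definitions using (Injective)
open import Relation.Binary.Definitions using (tri<; tri≈; tri>)
open import Relation.Binary.PropositionalEquality
open import Relation.Nullary using (contradiction)
open import Relation.Unary using (Pred; _∈_)
open import Defs

StrictlyIncreasing : (ℕ → ℕ) → Set
StrictlyIncreasing u = ∀ {i j} → i < j → u i < u j

module _ {u : ℕ → ℕ} (u-mono : StrictlyIncreasing u) where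

  increasing⇒≤ : ∀ {i j} → i ≤ j → u i ≤ u j
  increasing⇒≤ i≤j with m≤n⇒m<n∨m≡n i≤j
  ... | inj₁ i<j  = <⇒≤ (u-mono i<j)
  ... | inj₂ refl = ≤-refl

  increasing⇒cancel-< : ∀ {i j} → u i < u j → i < j
  increasing⇒cancel-< ui<uj = ≰⇒> (<⇒≱ ui<uj ∘ increasing⇒≤)

  increasing⇒injective : Injective _≡_ _≡_ u
  increasing⇒injective {i} {j} eq with <-cmp i j
  ... | tri< i<j _ _ = contradiction eq (<⇒≢ (u-mono i<j))
  ... | tri≈ _ i≡j _ = i≡j
  ... | tri> _ _ j<i = contradiction (sym eq) (<⇒≢ (u-mono j<i))

-- Sequences that respect a common segment decomposition are interlaced.
Interlaced : ℕ → (u v : ℕ → ℕ) → Set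
Interlaced l u v = ∀ i → suc i < l → u i ≤ v (suc i) × v i ≤ u (suc i)

-- The two branches of Pascal's recursion: the first pair of neighbours, with values 0 and 1, is
-- either filled by positions 0 and 1 or left empty.
takePair skipPair : (ℕ → ℕ) → ℕ → ℕ
takePair u 0             = 0
takePair u 1             = 1
takePair u (suc (suc i)) = 2 + u i
skipPair u i = 2 + u i

takePair-increasing : ∀ {u} → StrictlyIncreasing u → StrictlyIncreasing (takePair u)
takePair-increasing u-mono {0}           {1}           _   = z<s
takePair-increasing u-mono {0}           {suc (suc j)} _   = z<s
takePair-increasing u-mono {1}           {1}           (s<s ())
takePair-increasing u-mono {1}           {suc (suc j)} _   = s<s z<s
takePair-increasing u-mono {suc (suc i)} {1}           (s<s ())
takePair-increasing u-mono {suc (suc i)} {suc (suc j)} i<j =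
  s<s (s<s (u-mono (s<s⁻¹ (s<s⁻¹ i<j))))

-- Sequences are total on ℕ; only their first 2h (or, for odd k, 2h + 1) terms
-- matter, and `end` bounds these.
record PairFamily (N m h : ℕ) : Set where
  field
    seq        : Fin N → ℕ → ℕ
    increasing : ∀ a → StrictlyIncreasing (seq a)
    end        : ∀ a → seq a (h * 2) ≡ m * 2
    separated  : ∀ {a b} → Interlaced (h * 2) (seq a) (seq b) → a ≡ b

-- Choices of `suc h` among `suc m` pairs split by whether the first pair is chosen: `F` supplies
-- the rest if it is, `G` if it is not.
pascal : ∀ {M N m h} → PairFamily M m h → PairFamily N m (suc h) →
         PairFamily (M + N) (suc m) (suc h)
pascal {M} {N} {m} {h} F G = record
  { seq        = seq ∘ splitAt M
  ; increasing = increasing ∘ splitAt M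
  ; end        = end ∘ splitAt M
  ; separated  = λ {a} {b} p →
      trans (sym (join-splitAt M N a))
        (trans (cong (join M N) (separated (splitAt M a) (splitAt M b) p))
               (join-splitAt M N b))
  }
  where
  module F = PairFamily F
  module G = PairFamily G

  seq : Fin M ⊎ Fin N → ℕ → ℕ
  seq (inj₁ a) = takePair (F.seq a)
  seq (inj₂ a) = skipPair (G.seq a)

  increasing : ∀ a → StrictlyIncreasing (seq a)
  increasing (inj₁ a)     = takePair-increasing (F.increasing a)
  increasing (inj₂ a) i<j = s<s (s<s (G.increasing a i<j))

  end : ∀ a → seq a (suc h * 2) ≡ suc m * 2
  end (inj₁ a) = cong (2 +_) (F.end a)
  end (inj₂ a) = cong (2 +_) (G.end a)

  cancel : ∀ {x y} → 2 + x ≤ 2 + y → x ≤ y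
  cancel = s≤s⁻¹ ∘ s≤s⁻¹

  separated : ∀ a b → Interlaced (suc h * 2) (seq a) (seq b) → a ≡ b
  -- Both sequences start with the same pair, so interlacing passes to the tails from index 2 on.
  separated (inj₁ a) (inj₁ b) p = cong inj₁ (F.separated λ i i<l →
    let x , y = p (2 + i) (s<s (s<s i<l)) in cancel x , cancel y)
  -- When only one sequence takes the first pair, interlacing at index 0 would bound a first value
  -- of at least 2 by the second value 1.
  separated (inj₁ a) (inj₂ b) p with s≤s () ← proj₂ (p 0 (s<s z<s))
  separated (inj₂ a) (inj₁ b) p with s≤s () ← proj₁ (p 0 (s<s z<s))
  -- Skipping uses up no positions: the values shift, the indices do not.
  separated (inj₂ a) (inj₂ b) p = cong inj₂ (G.separated λ i i<l →
    let x , y = p i i<l in cancel x , cancel y)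

pairFamily : ∀ m h → PairFamily (m C h) m h
-- No pair remains to be chosen, so all `m` are skipped and position 0 takes `m * 2`, the first
-- value past them.
pairFamily m zero = record
  { seq        = λ _ i → m * 2 + i
  ; increasing = λ _ → +-monoʳ-< (m * 2)
  ; end        = λ _ → +-identityʳ (m * 2)
  ; separated  = λ { {Fin.zero} {Fin.zero} _ → refl }
  }
pairFamily zero (suc h) = record
  { seq = λ () ; increasing = λ () ; end = λ () ; separated = λ { {()} } }
pairFamily (suc m) (suc h) =
  subst (λ N → PairFamily N (suc m) (suc h)) (nCk+nC[k+1]≡[n+1]C[k+1] m h)
    (pascal (pairFamily m h) (pairFamily m (suc h)))

respects⇒≤ : ∀ {n k} {D : Vec Segment k} {f g : Fin k → Fin n} →
             IsSegmentDecomposition n D → Respects f D → Respects g D →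
             ∀ i j → toℕ j ≡ suc (toℕ i) → toℕ (f i) ≤ toℕ (g j)
-- `s≤s⁻¹` removes the shift by one built into `⌜_⌝`.
respects⇒≤ D-dec f-resp g-resp i j j≡1+i = s≤s⁻¹ (drop‿+≤+
  (ℤ.≤-trans (proj₂ (f-resp i)) (ℤ.≤-trans (ordered i j j≡1+i) (proj₁ (g-resp j)))))
  where open IsSegmentDecomposition D-dec

module Restriction {n k} (u : ℕ → ℕ) (bound : ∀ i → i < k → u i < n) where

  restrict : Fin k → Fin n
  restrict i = fromℕ< (bound (toℕ i) (toℕ<n i))

  toℕ-restrict : ∀ i → toℕ (restrict i) ≡ u (toℕ i)
  toℕ-restrict i = toℕ-fromℕ< (bound (toℕ i) (toℕ<n i))

  -- With identities for both permutations, the condition on values becomes the condition on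
  -- positions.
  restrict-isSolution : StrictlyIncreasing u → IsSolution idₚ idₚ restrict
  restrict-isSolution u-mono = record
    { injective = λ {i} {j} eq → toℕ-injective (increasing⇒injective u-mono
        (trans (sym (toℕ-restrict i)) (trans (cong toℕ eq) (toℕ-restrict j))))
    ; values    = order
    ; positions = order
    }
    where
    order : ∀ i j → (i Fin.< j) ⇔ (restrict i Fin.< restrict j)
    order i j = mk⇔
      (subst₂ _<_ (sym (toℕ-restrict i)) (sym (toℕ-restrict j)) ∘ u-mono)
      (increasing⇒cancel-< u-mono ∘ subst₂ _<_ (toℕ-restrict i) (toℕ-restrict j))

open Restriction

-- Applied in both orders of `u` and `v`, this yields the two halves of `Interlaced`.
respects⇒≤-restrict :
  ∀ {n k} {D : Vec Segment k} {u v : ℕ → ℕ}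
  (u-bound : ∀ i → i < k → u i < n) (v-bound : ∀ i → i < k → v i < n) →
  IsSegmentDecomposition n D →
  Respects (restrict u u-bound) D → Respects (restrict v v-bound) D →
  ∀ i → suc i < k → u i ≤ v (suc i)
respects⇒≤-restrict {u = u} {v} u-bound v-bound D-dec u-resp v-resp i 1+i<k =
  subst₂ _≤_
    (trans (toℕ-restrict u u-bound x) (cong u (toℕ-fromℕ< i<k)))
    (trans (toℕ-restrict v v-bound y) (cong v (toℕ-fromℕ< 1+i<k)))
    (respects⇒≤ D-dec u-resp v-resp x y
      (trans (toℕ-fromℕ< 1+i<k) (cong suc (sym (toℕ-fromℕ< i<k)))))
  where
  i<k = <-trans (n<1+n i) 1+i<k
  x = fromℕ< i<k
  y = fromℕ< 1+i<k

lemma5p1 : ∀ {p} (n k : ℕ) .{{_ : NonZero n}} .{{_ : NonZero k}}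
    (𝒟 : Pred (Vec Segment k) p) →
    (∀ (σ : Permutation′ n) (π : Permutation′ k) (f : Fin k → Fin n) →
    IsSolution σ π f →
    ∃! _≡_ (λ D → D ∈ 𝒟 × IsSegmentDecomposition n D × Respects f D)) →
    HasAtLeast (((n ∸ 1) / 2) C (k / 2)) 𝒟
lemma5p1 n@(suc n-1) k 𝒟 unique =
  D ,
  -- If `D a` equals `D b`, both solutions respect `D b`, so the sequences are interlaced up to `k`,
  -- hence up to `k / 2 * 2`.
  (λ {a} {b} D≡ → separated λ i 1+i<2h →
    let 1+i<k = <-≤-trans 1+i<2h (m/n*n≤m k 2)
    in respects⇒≤-restrict (bound a) (bound b) (D-dec b)
         (subst (Respects _) D≡ (D-resp a)) (D-resp b) i 1+i<k ,
       respects⇒≤-restrict (bound b) (bound a) (D-dec b)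
         (D-resp b) (subst (Respects _) D≡ (D-resp a)) i 1+i<k) ,
  λ a → proj₁ (spec a)
  where
  open PairFamily (pairFamily (n-1 / 2) (k / 2))

  k≤1+2h : k ≤ suc (k / 2 * 2)
  k≤1+2h = begin
    k                   ≡⟨ m≡m%n+[m/n]*n k 2 ⟩
    k % 2 + k / 2 * 2   ≤⟨ +-monoˡ-≤ (k / 2 * 2) (s≤s⁻¹ (m%n<n k 2)) ⟩
    suc (k / 2 * 2)     ∎
    where open ≤-Reasoning

  -- For odd `k` the index `k / 2 * 2` itself occurs and takes the value `n-1 / 2 * 2`. Pairing up
  -- only `n-1` of the `n` values leaves room for it.
  bound : ∀ a i → i < k → seq a i < n
  bound a i i<k = s≤s (begin
    seq a i             ≤⟨ increasing⇒≤ (increasing a) (s≤s⁻¹ (≤-trans i<k k≤1+2h)) ⟩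
    seq a (k / 2 * 2)   ≡⟨ end a ⟩
    n-1 / 2 * 2         ≤⟨ m/n*n≤m n-1 2 ⟩
    n-1                 ∎)
    where open ≤-Reasoning

  solution : Fin ((n-1 / 2) C (k / 2)) → Fin k → Fin n
  solution a = restrict (seq a) (bound a)

  decomposition : ∀ a →
    ∃! _≡_ (λ D → D ∈ 𝒟 × IsSegmentDecomposition n D × Respects (solution a) D)
  decomposition a = unique idₚ idₚ (solution a)
    (restrict-isSolution (seq a) (bound a) (increasing a))

  D : Fin ((n-1 / 2) C (k / 2)) → Vec Segment k
  D = proj₁ ∘ decomposition

  spec : ∀ a → D a ∈ 𝒟 × IsSegmentDecomposition n (D a) × Respects (solution a) (D a)
  spec = proj₁ ∘ proj₂ ∘ decomposition

  D-dec : ∀ a → IsSegmentDecomposition n (D a)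
  D-dec = proj₁ ∘ proj₂ ∘ spec

  D-resp : ∀ a → Respects (solution a) (D a)
  D-resp = proj₂ ∘ proj₂ ∘ spec
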